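{- Let $p,q\geq 3$ be integers with $p\neq 5$ and $q\neq 5$. Then $s_5(C_p\square C_q)=4$.
   Context: $P_k$ denotes the path on $k$ vertices, $C_k$ the cycle on $k$ vertices, and $\square$ denotes the Cartesian product of graphs. A $P_k$-coloring of a graph $G$ is a proper vertex coloring of $G$ in which no copy of $P_k$ in $G$ (as a subgraph, not necessarily induced) is bicolored, i.e. has its vertices colored using only two colors. The $P_k$-chromatic number $s_k(G)$ is the minimum number of colors in a $P_k$-coloring of $G$. -}

module Defs where

open import Data.Fin using (Fin; toℕ)
open import Data.Nat using (ℕ; suc; _≤_; s≤s)
open import Data.Nat.Properties using (1+n≢n)
open import Data.Product using (Σ; ∃₂; _×_; _,_)
open import Data.Sum using (_⊎_; inj₁; inj₂; swap)
open import Function.Definitions using (Injective)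
open import Relation.Binary.Core using (Rel)
open import Relation.Binary.Definitions using (Symmetric; Irreflexive)
open import Relation.Binary.PropositionalEquality using (_≡_; _≢_; refl; sym; trans; cong)
open import Relation.Nullary using (¬_)
open import Level using (0ℓ)

record Graph : Set₁ where
  field
    Vertex       : Set
    Adj          : Rel Vertex 0ℓ
    Adj-sym      : Symmetric Adj
    Adj-irrefl   : Irreflexive _≡_ Adj

open Graph public

path : ℕ → Graph
path k = record
  { Vertex     = Fin k
  ; Adj        = λ i j → suc (toℕ i) ≡ toℕ j ⊎ suc (toℕ j) ≡ toℕ i
  ; Adj-sym    = swap
  ; Adj-irrefl = λ { refl (inj₁ e) → 1+n≢n e ; refl (inj₂ e) → 1+n≢n e }
  }

-- j is the successor of i in the cyclic order 0, 1, …, k - 1, 0.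
CyclicSuc : ∀ {k} → Rel (Fin k) 0ℓ
CyclicSuc {k} i j = suc (toℕ i) ≡ toℕ j ⊎ (suc (toℕ i) ≡ k × toℕ j ≡ 0)

CyclicSuc-irrefl : ∀ {k} → 3 ≤ k → (i : Fin k) → ¬ CyclicSuc i i
CyclicSuc-irrefl _ i (inj₁ e) = 1+n≢n e
CyclicSuc-irrefl (s≤s (s≤s _)) i (inj₂ (e , z)) with trans (sym e) (cong suc z)
... | ()

cycle : (k : ℕ) → 3 ≤ k → Graph
cycle k 3≤k = record
  { Vertex     = Fin k
  ; Adj        = λ i j → CyclicSuc i j ⊎ CyclicSuc j i
  ; Adj-sym    = swap
  ; Adj-irrefl = λ { {i} refl (inj₁ s) → CyclicSuc-irrefl 3≤k i s
                   ; {i} refl (inj₂ s) → CyclicSuc-irrefl 3≤k i s }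
  }

infixr 7 _□_

_□_ : Graph → Graph → Graph
G □ H = record
  { Vertex     = Vertex G × Vertex H
  ; Adj        = λ (u , v) (u′ , v′) → (u ≡ u′ × Adj H v v′) ⊎ (Adj G u u′ × v ≡ v′)
  ; Adj-sym    = λ { (inj₁ (e , a)) → inj₁ (sym e , Adj-sym H a)
                   ; (inj₂ (a , e)) → inj₂ (Adj-sym G a , sym e) }
  ; Adj-irrefl = λ { refl (inj₁ (_ , a)) → Adj-irrefl H refl a
                   ; refl (inj₂ (a , _)) → Adj-irrefl G refl a }
  }

-- A copy of H in G as a subgraph, not necessarily induced.
record Copy (H G : Graph) : Set where
  field
    embed     : Vertex H → Vertex G
    injective : Injective _≡_ _≡_ embed
    preserves : ∀ {u v} → Adj H u v → Adj G (embed u) (embed v)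

open Copy public

Coloring : Graph → ℕ → Set
Coloring G n = Vertex G → Fin n

Proper : (G : Graph) {n : ℕ} → Coloring G n → Set
Proper G c = ∀ {u v} → Adj G u v → c u ≢ c v

Bicolored : {H G : Graph} {n : ℕ} → Coloring G n → Copy H G → Set
Bicolored {H} c f =
  ∃₂ λ a b → (x : Vertex H) → c (embed f x) ≡ a ⊎ c (embed f x) ≡ b

IsPathColoring : (k : ℕ) (G : Graph) {n : ℕ} → Coloring G n → Set
IsPathColoring k G c =
  Proper G c × ((f : Copy (path k) G) → ¬ Bicolored c f)

PathColorable : ℕ → Graph → ℕ → Set
PathColorable k G n = Σ (Coloring G n) (IsPathColoring k G)

-- s k G ≡ n, as a relation: on an arbitrary graph the minimum need not exist.
IsPathChromaticNumber : ℕ → Graph → ℕ → Set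
IsPathChromaticNumber k G n =
  PathColorable k G n × (∀ m → PathColorable k G m → n ≤ m)

{-# OPTIONS --safe #-}

-- Upper bound: if f and g colour G and H with the elements of the Klein
-- four-group so that all vertices at distance one or two get distinct colours,
-- then f u ⊕ g v is a P₅-colouring of G □ H.  Indeed, on a bicolored P₅ all four
-- edges have the same colour difference; two consecutive edges, or two
-- consecutive edges up to one interposed edge of the other factor, lying in the
-- same factor then retrace each other.  So the factors alternate and the fourth
-- edge closes a square, which is not a path.  A cycle of length p has such a
-- colouring when p = 3a + 4b, that is when p ≠ 5.
--
-- Lower bound: already the 3 × 3 grid has no P₅-colouring with three colours.
-- If three neighbours of the centre share a colour, there is a bicolored P₅
-- through these; otherwise the neighbours split two against two, every corner
-- between neighbours of different colours has the colour of the centre, and two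
-- such corners are joined by a bicolored P₅ through two equal neighbours.
module Submission where

open import Defs
open import Data.Fin using (Fin; toℕ; inject≤; opposite)
open import Data.Fin.Patterns using (0F; 1F; 2F; 3F; 4F)
open import Data.Fin.Properties using (_≟_; all?; toℕ<n; toℕ-injective; toℕ-inject≤; inject≤-injective)
open import Data.List using (List; []; _∷_; map; concatMap)
open import Data.List.Relation.Unary.All as All using (All)
open import Data.List.Relation.Unary.Any as Any using (Any; any?)
open import Data.Nat using (ℕ; suc; _+_; _≤_; _<_; s≤s)
open import Data.Nat.Properties as ℕ using (≰⇒>; suc-injective; 1+n≢0)
open import Data.Product using (∃; _×_; _,_; proj₁; proj₂)
open import Data.Product.Properties using (≡-dec)
open import Data.Sum as Sum using (_⊎_; inj₁; inj₂)
open import Data.Vec as Vec using (Vec; []; _∷_; lookup)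
open import Function using (_∘_; id)
open import Relation.Binary.Definitions using (Decidable)
open import Relation.Binary.PropositionalEquality using (_≡_; _≢_; refl; sym; trans; cong; cong₂; subst; subst₂)
open import Relation.Nullary using (¬_; Dec; contradiction)
open import Relation.Nullary.Decidable using (True; toWitness; from-yes; ¬?; _→-dec_; _×-dec_; _⊎-dec_)

-- Copies and alternating paths

infixr 9 _∘ᶜ_

_∘ᶜ_ : ∀ {F G H} → Copy G H → Copy F G → Copy F H
g ∘ᶜ f = record
  { embed     = embed g ∘ embed f
  ; injective = injective f ∘ injective g
  ; preserves = preserves g ∘ preserves f
  }

_□ᶜ_ : ∀ {G G′ H H′} → Copy G G′ → Copy H H′ → Copy (G □ H) (G′ □ H′)
f □ᶜ g = record
  { embed     = λ (u , v) → embed f u , embed g v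
  ; injective = λ e → cong₂ _,_ (injective f (cong proj₁ e)) (injective g (cong proj₂ e))
  ; preserves = λ { (inj₁ (e , a)) → inj₁ (cong (embed f) e , preserves g a)
                  ; (inj₂ (a , e)) → inj₂ (preserves f a , cong (embed g) e) }
  }

path⊆cycle : ∀ {k p} (3≤p : 3 ≤ p) → k ≤ p → Copy (path k) (cycle p 3≤p)
path⊆cycle 3≤p k≤p = record
  { embed     = λ i → inject≤ i k≤p
  ; injective = inject≤-injective k≤p k≤p _ _
  ; preserves = Sum.map (inj₁ ∘ step) (inj₁ ∘ step)
  }
  where
  step : ∀ {i j} → suc (toℕ i) ≡ toℕ j → suc (toℕ (inject≤ i k≤p)) ≡ toℕ (inject≤ j k≤p)
  step {i} {j} rewrite toℕ-inject≤ i k≤p | toℕ-inject≤ j k≤p = id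

-- What being bicolored amounts to on a properly coloured path, without naming the two colours; in
-- this form it can be decided by comparing entries.
Alternating : ∀ {A : Set} → (Fin 5 → A) → Set
Alternating x = x 0F ≡ x 2F × x 1F ≡ x 3F × x 2F ≡ x 4F

alternating⇒bicolored : ∀ {G n} (c : Coloring G n) (f : Copy (path 5) G) →
                        Alternating (c ∘ embed f) → Bicolored c f
alternating⇒bicolored c f (e₀₂ , e₁₃ , e₂₄) = c (embed f 0F) , c (embed f 1F) , λ where
  0F → inj₁ refl
  1F → inj₂ refl
  2F → inj₁ (sym e₀₂)
  3F → inj₂ (sym e₁₃)
  4F → inj₁ (sym (trans e₀₂ e₂₄))

-- `x` takes one of the two colours, so `y` takes the other and `z` the first again.
two-colors : ∀ {A : Set} {a b x y z : A} → x ≢ y → y ≢ z →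
             x ≡ a ⊎ x ≡ b → y ≡ a ⊎ y ≡ b → z ≡ a ⊎ z ≡ b → x ≡ z
two-colors x≢y y≢z (inj₁ refl) (inj₁ refl) _           = contradiction refl x≢y
two-colors x≢y y≢z (inj₁ refl) (inj₂ refl) (inj₁ refl) = refl
two-colors x≢y y≢z (inj₁ refl) (inj₂ refl) (inj₂ refl) = contradiction refl y≢z
two-colors x≢y y≢z (inj₂ refl) (inj₂ refl) _           = contradiction refl x≢y
two-colors x≢y y≢z (inj₂ refl) (inj₁ refl) (inj₂ refl) = refl
two-colors x≢y y≢z (inj₂ refl) (inj₁ refl) (inj₁ refl) = contradiction refl y≢z

bicolored⇒alternating : ∀ {G n} {c : Coloring G n} → Proper G c → (f : Copy (path 5) G) →
                        Bicolored c f → Alternating (c ∘ embed f)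
bicolored⇒alternating proper f (a , b , h) =
    two-colors (edge refl) (edge refl) (h 0F) (h 1F) (h 2F)
  , two-colors (edge refl) (edge refl) (h 1F) (h 2F) (h 3F)
  , two-colors (edge refl) (edge refl) (h 2F) (h 3F) (h 4F)
  where
  edge : ∀ {i j} → suc (toℕ i) ≡ toℕ j → _
  edge e = proper (preserves f (inj₁ e))

-- The Klein four-group on Fin 4

infixl 6 _⊕_

abstract
  -- Bitwise exclusive or of two-bit numbers.
  _⊕_ : Fin 4 → Fin 4 → Fin 4
  a ⊕ b = lookup (lookup table a) b
    where
    table : Vec (Vec (Fin 4) 4) 4
    table = (0F ∷ 1F ∷ 2F ∷ 3F ∷ [])
          ∷ (1F ∷ 0F ∷ 3F ∷ 2F ∷ [])
          ∷ (2F ∷ 3F ∷ 0F ∷ 1F ∷ [])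
          ∷ (3F ∷ 2F ∷ 1F ∷ 0F ∷ [])
          ∷ []

  ⊕-comm : ∀ a b → a ⊕ b ≡ b ⊕ a
  ⊕-comm = from-yes (all? λ a → all? λ b → a ⊕ b ≟ b ⊕ a)

  ⊕-cancelʳ : ∀ x a b → a ⊕ x ≡ b ⊕ x → a ≡ b
  ⊕-cancelʳ = from-yes (all? λ x → all? λ a → all? λ b → (a ⊕ x ≟ b ⊕ x) →-dec (a ≟ b))

  ⊕-cancelˡ : ∀ x a b → x ⊕ a ≡ x ⊕ b → a ≡ b
  ⊕-cancelˡ x a b e = ⊕-cancelʳ x a b (trans (⊕-comm a x) (trans e (⊕-comm x b)))

  -- Adding the hypotheses gives a ⊕ b ≡ b ⊕ c, as x ⊕ x vanishes.
  ⊕-retraceˡ : ∀ a b c x y → a ⊕ x ≡ b ⊕ y → b ⊕ x ≡ c ⊕ y → a ≡ c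
  ⊕-retraceˡ = from-yes (all? λ a → all? λ b → all? λ c → all? λ x → all? λ y →
    (a ⊕ x ≟ b ⊕ y) →-dec ((b ⊕ x ≟ c ⊕ y) →-dec (a ≟ c)))

  ⊕-retraceʳ : ∀ a b c x y → x ⊕ a ≡ y ⊕ b → x ⊕ b ≡ y ⊕ c → a ≡ c
  ⊕-retraceʳ a b c x y e e′ = ⊕-retraceˡ a b c x y
    (trans (⊕-comm a x) (trans e (⊕-comm y b)))
    (trans (⊕-comm b x) (trans e′ (⊕-comm y c)))

-- Upper bound

-- Together with properness this separates all vertices at distance one or two. A walk may turn
-- back, hence the conclusion `u ≡ w`.
LocallyInjective : (G : Graph) {n : ℕ} → Coloring G n → Set
LocallyInjective G c = ∀ {u v w} → Adj G u v → Adj G v w → c u ≡ c w → u ≡ w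

module _ {G H : Graph} {f : Coloring G 4} {g : Coloring H 4}
         (f-proper : Proper G f) (g-proper : Proper H g)
         (f-inj : LocallyInjective G f) (g-inj : LocallyInjective H g) where

  ⊕-coloring : Coloring (G □ H) 4
  ⊕-coloring (u , v) = f u ⊕ g v

  ⊕-proper : Proper (G □ H) ⊕-coloring
  ⊕-proper {u , _} (inj₁ (refl , a)) e = g-proper a (⊕-cancelˡ (f u) _ _ e)
  ⊕-proper {_ , v} (inj₂ (a , refl)) e = f-proper a (⊕-cancelʳ (g v) _ _ e)

  -- The first six clauses treat two consecutive edges in one factor: the summand of the other
  -- factor cancels and local injectivity applies. The last two treat alternating factors.
  alternating-walk-returns : ∀ {w₀ w₁ w₂ w₃ w₄} →
    Adj (G □ H) w₀ w₁ → Adj (G □ H) w₁ w₂ → Adj (G □ H) w₂ w₃ → Adj (G □ H) w₃ w₄ →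
    ⊕-coloring w₀ ≡ ⊕-coloring w₂ → ⊕-coloring w₁ ≡ ⊕-coloring w₃ →
    ⊕-coloring w₂ ≡ ⊕-coloring w₄ →
    w₀ ≡ w₂ ⊎ w₁ ≡ w₃ ⊎ w₂ ≡ w₄ ⊎ w₀ ≡ w₄
  alternating-walk-returns (inj₁ (refl , a)) (inj₁ (refl , b)) _ _ e _ _ =
    inj₁ (cong (_ ,_) (g-inj a b (⊕-cancelˡ _ _ _ e)))
  alternating-walk-returns (inj₂ (a , refl)) (inj₂ (b , refl)) _ _ e _ _ =
    inj₁ (cong (_, _) (f-inj a b (⊕-cancelʳ _ _ _ e)))
  alternating-walk-returns _ (inj₁ (refl , a)) (inj₁ (refl , b)) _ _ e _ =
    inj₂ (inj₁ (cong (_ ,_) (g-inj a b (⊕-cancelˡ _ _ _ e))))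
  alternating-walk-returns _ (inj₂ (a , refl)) (inj₂ (b , refl)) _ _ e _ =
    inj₂ (inj₁ (cong (_, _) (f-inj a b (⊕-cancelʳ _ _ _ e))))
  alternating-walk-returns _ _ (inj₁ (refl , a)) (inj₁ (refl , b)) _ _ e =
    inj₂ (inj₂ (inj₁ (cong (_ ,_) (g-inj a b (⊕-cancelˡ _ _ _ e)))))
  alternating-walk-returns _ _ (inj₂ (a , refl)) (inj₂ (b , refl)) _ _ e =
    inj₂ (inj₂ (inj₁ (cong (_, _) (f-inj a b (⊕-cancelʳ _ _ _ e)))))
  -- Write the walk as (u, v), (u, v′), (u′, v′), (u′, v″), (u″, v″). The last two equations give
  -- `f u ≡ f u″` and the first two `g v ≡ g v″`, so the walk closes a square.
  alternating-walk-returns (inj₁ (refl , a)) (inj₂ (b , refl)) (inj₁ (refl , a′)) (inj₂ (b′ , refl)) e₀₂ e₁₃ e₂₄ =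
    inj₂ (inj₂ (inj₂ (cong₂ _,_ (f-inj b b′ (⊕-retraceˡ _ _ _ _ _ e₁₃ e₂₄))
                                (g-inj a a′ (⊕-retraceʳ _ _ _ _ _ e₀₂ e₁₃)))))
  alternating-walk-returns (inj₂ (a , refl)) (inj₁ (refl , b)) (inj₂ (a′ , refl)) (inj₁ (refl , b′)) e₀₂ e₁₃ e₂₄ =
    inj₂ (inj₂ (inj₂ (cong₂ _,_ (f-inj a a′ (⊕-retraceˡ _ _ _ _ _ e₀₂ e₁₃))
                                (g-inj b b′ (⊕-retraceʳ _ _ _ _ _ e₁₃ e₂₄)))))

  ⊕-no-alternating : (h : Copy (path 5) (G □ H)) → ¬ Alternating (⊕-coloring ∘ embed h)
  ⊕-no-alternating h (e₀₂ , e₁₃ , e₂₄)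
    with alternating-walk-returns (edge {0F} {1F} refl) (edge {1F} {2F} refl)
                                  (edge {2F} {3F} refl) (edge {3F} {4F} refl) e₀₂ e₁₃ e₂₄
    where
    edge : ∀ {i j} → suc (toℕ i) ≡ toℕ j → Adj (G □ H) (embed h i) (embed h j)
    edge e = preserves h (inj₁ e)
  ... | inj₁ e               = contradiction (injective h e) λ ()
  ... | inj₂ (inj₁ e)        = contradiction (injective h e) λ ()
  ... | inj₂ (inj₂ (inj₁ e)) = contradiction (injective h e) λ ()
  ... | inj₂ (inj₂ (inj₂ e)) = contradiction (injective h e) λ ()

  □-pathColorable : PathColorable 5 (G □ H) 4
  □-pathColorable = ⊕-coloring , ⊕-proper ,
    λ h → ⊕-no-alternating h ∘ bicolored⇒alternating ⊕-proper h

-- Colouring cycles by blocks of lengths three and four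

data Blocks : ℕ → Set where
  []    : Blocks 0
  three : ∀ {n} → Blocks n → Blocks (3 + n)
  four  : ∀ {n} → Blocks n → Blocks (4 + n)

-- The numbers 6, 7 and 8 represent all residues modulo three.
blocks-from-6 : ∀ n → Blocks (6 + n)
blocks-from-6 0                   = three (three [])
blocks-from-6 1                   = three (four [])
blocks-from-6 2                   = four (four [])
blocks-from-6 (suc (suc (suc n))) = three (blocks-from-6 n)

blocks : ∀ p → 3 ≤ p → p ≢ 5 → Blocks p
blocks 1 (s≤s ())
blocks 2 (s≤s (s≤s ()))
blocks 3 _ _   = three []
blocks 4 _ _   = four []
blocks 5 _ 5≢5 = contradiction refl 5≢5
blocks (suc (suc (suc (suc (suc (suc n)))))) _ _ = blocks-from-6 n

-- The position of an index within its block.  An index beyond the last block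
-- gets position 0, so that the word closes up cyclically.
position : ∀ {n} → Blocks n → ℕ → Fin 4
position []        _                         = 0F
position (three b) 0                         = 0F
position (three b) 1                         = 1F
position (three b) 2                         = 2F
position (three b) (suc (suc (suc i)))       = position b i
position (four b)  0                         = 0F
position (four b)  1                         = 1F
position (four b)  2                         = 2F
position (four b)  3                         = 3F
position (four b)  (suc (suc (suc (suc i)))) = position b i

-- The transitions in cyclic words built from 012 and 0123. This directed graph has neither loops
-- nor two-cycles, which makes the colouring proper and locally injective.
data Next : Fin 4 → Fin 4 → Set where
  0→1 : Next 0F 1F
  1→2 : Next 1F 2F
  2→0 : Next 2F 0F
  2→3 : Next 2F 3F
  3→0 : Next 3F 0F

next-irrefl : ∀ {a b} → Next a b → a ≢ b
next-irrefl () refl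

next²-irrefl : ∀ {a b c} → Next a b → Next b c → a ≢ c
next²-irrefl 0→1 () refl
next²-irrefl 1→2 () refl
next²-irrefl 2→0 () refl
next²-irrefl 2→3 () refl
next²-irrefl 3→0 () refl

position-first : ∀ {n} (b : Blocks n) → position b 0 ≡ 0F
position-first []        = refl
position-first (three b) = refl
position-first (four b)  = refl

position-end : ∀ {n} (b : Blocks n) → position b n ≡ 0F
position-end []        = refl
position-end (three b) = position-end b
position-end (four b)  = position-end b

position-next : ∀ {n} (b : Blocks n) i → i < n → Next (position b i) (position b (suc i))
position-next (three b) 0 _ = 0→1
position-next (three b) 1 _ = 1→2
-- The next index opens another block or lies past the last one; its position is 0 either way.
position-next (three b) 2 _ = subst (Next 2F) (sym (position-first b)) 2→0
position-next (three b) (suc (suc (suc i))) (s≤s (s≤s (s≤s i<n))) = position-next b i i<n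
position-next (four b)  0 _ = 0→1
position-next (four b)  1 _ = 1→2
position-next (four b)  2 _ = 2→3
position-next (four b)  3 _ = subst (Next 3F) (sym (position-first b)) 3→0
position-next (four b)  (suc (suc (suc (suc i)))) (s≤s (s≤s (s≤s (s≤s i<n)))) = position-next b i i<n

CyclicSuc-functional : ∀ {k} {i j j′ : Fin k} → CyclicSuc i j → CyclicSuc i j′ → j ≡ j′
CyclicSuc-functional (inj₁ e) (inj₁ e′) = toℕ-injective (trans (sym e) e′)
CyclicSuc-functional {j = j} (inj₁ e) (inj₂ (e′ , _)) =
  contradiction (trans (sym e) e′) (ℕ.<⇒≢ (toℕ<n j))
CyclicSuc-functional {j′ = j′} (inj₂ (e , _)) (inj₁ e′) =
  contradiction (trans (sym e′) e) (ℕ.<⇒≢ (toℕ<n j′))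
CyclicSuc-functional (inj₂ (_ , z)) (inj₂ (_ , z′)) = toℕ-injective (trans z (sym z′))

CyclicSuc-injective : ∀ {k} {i i′ j : Fin k} → CyclicSuc i j → CyclicSuc i′ j → i ≡ i′
CyclicSuc-injective (inj₁ e) (inj₁ e′) = toℕ-injective (suc-injective (trans e (sym e′)))
CyclicSuc-injective (inj₁ e) (inj₂ (_ , z)) = contradiction (trans e z) 1+n≢0
CyclicSuc-injective (inj₂ (_ , z)) (inj₁ e) = contradiction (trans e z) 1+n≢0
CyclicSuc-injective (inj₂ (e , _)) (inj₂ (e′ , _)) = toℕ-injective (suc-injective (trans e (sym e′)))

module _ {p : ℕ} (3≤p : 3 ≤ p) (b : Blocks p) where

  cycle-coloring : Coloring (cycle p 3≤p) 4
  cycle-coloring i = position b (toℕ i)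

  cycle-next : ∀ {i j} → CyclicSuc i j → Next (cycle-coloring i) (cycle-coloring j)
  cycle-next {i} (inj₁ e) =
    subst (λ x → Next (cycle-coloring i) (position b x)) e (position-next b (toℕ i) (toℕ<n i))
  -- On the closing edge the index `p`, just past the end, has the same position 0 as the index 0.
  cycle-next {i} (inj₂ (e , z)) =
    subst (Next (cycle-coloring i))
          (trans (cong (position b) e)
                 (trans (position-end b) (trans (sym (position-first b)) (cong (position b) (sym z)))))
          (position-next b (toℕ i) (toℕ<n i))

  cycle-proper : Proper (cycle p 3≤p) cycle-coloring
  cycle-proper (inj₁ s) = next-irrefl (cycle-next s)
  cycle-proper (inj₂ s) = next-irrefl (cycle-next s) ∘ sym

  -- Two steps in one direction change the colour by `next²-irrefl`; a walk that turns back returns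
  -- to its start, as successors and predecessors are unique.
  cycle-locallyInjective : LocallyInjective (cycle p 3≤p) cycle-coloring
  cycle-locallyInjective (inj₁ s) (inj₁ t) e =
    contradiction e (next²-irrefl (cycle-next s) (cycle-next t))
  cycle-locallyInjective (inj₁ s) (inj₂ t) _ = CyclicSuc-injective s t
  cycle-locallyInjective (inj₂ s) (inj₁ t) _ = CyclicSuc-functional s t
  cycle-locallyInjective (inj₂ s) (inj₂ t) e =
    contradiction (sym e) (next²-irrefl (cycle-next t) (cycle-next s))

-- Lower bound

grid : Graph
grid = path 3 □ path 3

path-adj? : ∀ k → Decidable (Adj (path k))
path-adj? k i j = (suc (toℕ i) ℕ.≟ toℕ j) ⊎-dec (suc (toℕ j) ℕ.≟ toℕ i)

grid-adj? : Decidable (Adj grid)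
grid-adj? (u , v) (u′ , v′) =
  ((u ≟ u′) ×-dec path-adj? 3 v v′) ⊎-dec (path-adj? 3 u u′ ×-dec (v ≟ v′))

IsPath : Vec (Vertex grid) 5 → Set
IsPath w = (∀ i j → lookup w i ≡ lookup w j → i ≡ j)
         × (∀ i j → Adj (path 5) i j → Adj grid (lookup w i) (lookup w j))

isPath? : ∀ w → Dec (IsPath w)
isPath? w =
    (all? λ i → all? λ j → ≡-dec _≟_ _≟_ (lookup w i) (lookup w j) →-dec (i ≟ j))
  ×-dec
    (all? λ i → all? λ j → path-adj? 5 i j →-dec grid-adj? (lookup w i) (lookup w j))

toCopy : ∀ w → IsPath w → Copy (path 5) grid
toCopy w (inj , pres) = record
  { embed     = lookup w
  ; injective = inj _ _
  ; preserves = pres _ _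
  }

-- The first three paths handle three equal neighbours (0,1), (1,2), (2,1) of the
-- centre, the last two handle two opposite resp. two adjacent equal neighbours.
paths : List (Vec (Vertex grid) 5)
paths = concatMap (λ r → map (Vec.map r)
  ( ((1F , 2F) ∷ (0F , 2F) ∷ (0F , 1F) ∷ (1F , 1F) ∷ (2F , 1F) ∷ [])
  ∷ ((1F , 2F) ∷ (2F , 2F) ∷ (2F , 1F) ∷ (1F , 1F) ∷ (0F , 1F) ∷ [])
  ∷ ((0F , 1F) ∷ (0F , 2F) ∷ (1F , 2F) ∷ (2F , 2F) ∷ (2F , 1F) ∷ [])
  ∷ ((0F , 2F) ∷ (0F , 1F) ∷ (1F , 1F) ∷ (2F , 1F) ∷ (2F , 2F) ∷ [])
  ∷ ((0F , 0F) ∷ (0F , 1F) ∷ (1F , 1F) ∷ (1F , 2F) ∷ (2F , 2F) ∷ [])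
  ∷ []))
  (id ∷ rotate ∷ rotate ∘ rotate ∷ rotate ∘ rotate ∘ rotate ∷ [])
  where
  -- The quarter turn about the centre; its four powers place each path in every orientation.
  rotate : Vertex grid → Vertex grid
  rotate (x , y) = y , opposite x

paths-valid : All IsPath paths
paths-valid = from-yes (All.all? isPath? paths)

-- Nine separate entries turn a quantifier over colourings into quantifiers over colours, which
-- `all?` decides.
matrix : ∀ {A : Set} (nw n ne w o e sw s se : A) → Vertex grid → A
matrix nw n ne w o e sw s se (x , y) =
  lookup (lookup ((nw ∷ n ∷ ne ∷ []) ∷ (w ∷ o ∷ e ∷ []) ∷ (sw ∷ s ∷ se ∷ []) ∷ []) x) y

matrix-entries : ∀ {A : Set} (c : Vertex grid → A) v →
  matrix (c (0F , 0F)) (c (0F , 1F)) (c (0F , 2F))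
         (c (1F , 0F)) (c (1F , 1F)) (c (1F , 2F))
         (c (2F , 0F)) (c (2F , 1F)) (c (2F , 2F)) v ≡ c v
matrix-entries c (0F , 0F) = refl
matrix-entries c (0F , 1F) = refl
matrix-entries c (0F , 2F) = refl
matrix-entries c (1F , 0F) = refl
matrix-entries c (1F , 1F) = refl
matrix-entries c (1F , 2F) = refl
matrix-entries c (2F , 0F) = refl
matrix-entries c (2F , 1F) = refl
matrix-entries c (2F , 2F) = refl

alternating? : ∀ {m} (x : Fin 5 → Fin m) → Dec (Alternating x)
alternating? x = (x 0F ≟ x 2F) ×-dec ((x 1F ≟ x 3F) ×-dec (x 2F ≟ x 4F))

-- An exhaustive check. Each properness condition directly follows the colour it restricts, so that
-- improper branches are cut early.
matrix-alternates : (o n : Fin 3) → o ≢ n → ∀ e → o ≢ e → ∀ s → o ≢ s → ∀ w → o ≢ w →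
  ∀ nw → n ≢ nw × w ≢ nw → ∀ ne → n ≢ ne × e ≢ ne →
  ∀ se → s ≢ se × e ≢ se → ∀ sw → s ≢ sw × w ≢ sw →
  Any (λ v → Alternating (matrix nw n ne w o e sw s se ∘ lookup v)) paths
matrix-alternates = from-yes
  (all? λ o → all? λ n → (o ≢? n) →-dec (all? λ e → (o ≢? e) →-dec
  (all? λ s → (o ≢? s) →-dec (all? λ w → (o ≢? w) →-dec
  (all? λ nw → ((n ≢? nw) ×-dec (w ≢? nw)) →-dec
  (all? λ ne → ((n ≢? ne) ×-dec (e ≢? ne)) →-dec
  (all? λ se → ((s ≢? se) ×-dec (e ≢? se)) →-dec
  (all? λ sw → ((s ≢? sw) ×-dec (w ≢? sw)) →-dec
  any? (λ v → alternating? (matrix nw n ne w o e sw s se ∘ lookup v)) paths))))))))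
  where
  _≢?_ : (i j : Fin 3) → Dec (i ≢ j)
  i ≢? j = ¬? (i ≟ j)

grid-alternates : (c : Coloring grid 3) → Proper grid c →
                  Any (λ v → Alternating (c ∘ lookup v)) paths
grid-alternates c proper = Any.map (λ {v} → subst-entries v)
  (matrix-alternates _ _ (adj o n) _ (adj o e) _ (adj o s) _ (adj o w)
     _ (adj n nw , adj w nw) _ (adj n ne , adj e ne)
     _ (adj s se , adj e se) _ (adj s sw , adj w sw))
  where
  nw n ne w o e sw s se : Vertex grid
  nw = 0F , 0F ; n = 0F , 1F ; ne = 0F , 2F
  w  = 1F , 0F ; o = 1F , 1F ; e  = 1F , 2F
  sw = 2F , 0F ; s = 2F , 1F ; se = 2F , 2F

  entries : Vertex grid → Fin 3
  entries = matrix (c nw) (c n) (c ne) (c w) (c o) (c e) (c sw) (c s) (c se)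

  adj : ∀ u v → {True (grid-adj? u v)} → c u ≢ c v
  adj u v {a} = proper {u} {v} (toWitness a)

  -- `entries` agrees with `c` only pointwise, so each equation is transported separately.
  subst-entries : ∀ v → Alternating (entries ∘ lookup v) → Alternating (c ∘ lookup v)
  subst-entries v (e₀₂ , e₁₃ , e₂₄) = entry 0F 2F e₀₂ , entry 1F 3F e₁₃ , entry 2F 4F e₂₄
    where
    entry : ∀ i j → entries (lookup v i) ≡ entries (lookup v j) → c (lookup v i) ≡ c (lookup v j)
    entry i j = subst₂ _≡_ (matrix-entries c (lookup v i)) (matrix-entries c (lookup v j))

alternating-copy : ∀ {m} (c : Coloring grid m) {ws} → All IsPath ws →
                   Any (λ v → Alternating (c ∘ lookup v)) ws →
                   ∃ λ (h : Copy (path 5) grid) → Alternating (c ∘ embed h)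
alternating-copy c {v ∷ _} (valid All.∷ _)  (Any.here alt)  = toCopy v valid , alt
alternating-copy c         (_ All.∷ valids) (Any.there any) = alternating-copy c valids any

-- With at most three colours, an injection into `Fin 3` preserves properness and reflects
-- alternation, so the check on the grid applies.
grid⊆⇒3<colors : ∀ {G m} → Copy grid G → PathColorable 5 G m → 3 < m
grid⊆⇒3<colors {G} {m} g (c , proper , no-bicolored) = ≰⇒> λ m≤3 →
  let recolor : Fin m → Fin 3
      recolor i = inject≤ i m≤3

      recolor-injective : ∀ {i j} → recolor i ≡ recolor j → i ≡ j
      recolor-injective = inject≤-injective m≤3 m≤3 _ _

      h , alt₀₂ , alt₁₃ , alt₂₄ = alternating-copy (recolor ∘ c ∘ embed g) paths-valid
        (grid-alternates (recolor ∘ c ∘ embed g)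
                         (λ a → proper (preserves g a) ∘ recolor-injective))
  in no-bicolored (g ∘ᶜ h) (alternating⇒bicolored c (g ∘ᶜ h)
       (recolor-injective alt₀₂ , recolor-injective alt₁₃ , recolor-injective alt₂₄))

theorem10 : (p q : ℕ) (3≤p : 3 ≤ p) (3≤q : 3 ≤ q) → p ≢ 5 → q ≢ 5 →
    IsPathChromaticNumber 5 (cycle p 3≤p □ cycle q 3≤q) 4
theorem10 p q 3≤p 3≤q p≢5 q≢5 =
    □-pathColorable (cycle-proper 3≤p bp) (cycle-proper 3≤q bq)
                    (cycle-locallyInjective 3≤p bp) (cycle-locallyInjective 3≤q bq)
  -- The bounds `3≤p` and `3≤q` also say that `path 3` fits into each cycle; `3 < m` unfolds to
  -- `4 ≤ m`.
  , λ m → grid⊆⇒3<colors (path⊆cycle 3≤p 3≤p □ᶜ path⊆cycle 3≤q 3≤q)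
  where
  bp = blocks p 3≤p p≢5
  bq = blocks q 3≤q q≢5
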